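{- Let $\mathcal{G}=(\mathcal{V},\mathcal{E})$ be a finite undirected graph with $n=|\mathcal{V}|$ vertices and let $k$ be an integer with $0\le k\le n/2$. Let $\mathcal{P}$ be any assignment returned by the local-improvement algorithm (Algorithm 1, described in the context) on input $(\mathcal{G},k)$. Then $$\mathrm{IoA}(\mathcal{P})\ \ge\ \tfrac12\cdot \mathrm{OPT},$$ where $\mathrm{OPT}$ is the maximum of $\mathrm{IoA}$ over all assignments; that is, Algorithm 1 gives a $\frac12$-approximation for IM-IoA.
   Context: An instance of the problem IM-IoA consists of a finite undirected graph $\mathcal{G}=(\mathcal{V},\mathcal{E})$ with $n=|\mathcal{V}|$ and an integer $k\le n/2$. An assignment is a function $\mathcal{P}:\mathcal{V}\to\{1,2\}$ such that exactly $k$ vertices have type 1 and exactly $n-k$ vertices have type 2. A vertex is integrated under $\mathcal{P}$ if it has at least one neighbor in $\mathcal{G}$ whose type differs from its own. $\mathrm{IoA}(\mathcal{P})$ is the number of integrated vertices under $\mathcal{P}$. The problem IM-IoA asks for an assignment maximizing $\mathrm{IoA}$; the maximum is denoted $\mathrm{OPT}$. Algorithm 1 (local improvement): start from an arbitrary (random) assignment $\mathcal{P}$. As long as there are a type-1 vertex $x$ and a type-2 vertex $y$ such that the assignment $\mathcal{P}'$ obtained from $\mathcal{P}$ by exchanging the types of $x$ and $y$ satisfies $\mathrm{IoA}(\mathcal{P}')>\mathrm{IoA}(\mathcal{P})$, replace $\mathcal{P}$ by such a $\mathcal{P}'$. When no such pair exists, return $\mathcal{P}$. -}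

module Defs where

open import Data.Fin using (Fin)
open import Data.Fin.Permutation.Components using (transpose)
open import Data.Fin.Properties using (any?)
open import Data.List using (allFin; filter; length)
open import Data.Nat using (ℕ; _∸_; _≤_; _<_)
open import Data.Product using (∃-syntax; _×_)
open import Function using (_∘_)
open import Level using (0ℓ)
open import Relation.Binary using (Decidable; DecidableEquality; Rel; Symmetric)
open import Relation.Binary.Construct.Closure.ReflexiveTransitive using (Star)
open import Relation.Binary.PropositionalEquality using (_≡_; _≢_; refl)
open import Relation.Nullary using (¬_; yes; no)
open import Relation.Nullary.Decidable using (_×-dec_; ¬?)
open import Relation.Unary using (Pred) renaming (Decidable to Decidable₁)

-- Loops are not excluded: a vertex never differs in type from itself, so
-- they have no effect on which vertices are integrated.
record Graph (n : ℕ) : Set₁ where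
  field
    Adj     : Rel (Fin n) 0ℓ
    adj?    : Decidable Adj
    adj-sym : Symmetric Adj

data VertexType : Set where
  type₁ type₂ : VertexType

infix 4 _≟ᵗ_
_≟ᵗ_ : DecidableEquality VertexType
type₁ ≟ᵗ type₁ = yes refl
type₁ ≟ᵗ type₂ = no λ ()
type₂ ≟ᵗ type₁ = no λ ()
type₂ ≟ᵗ type₂ = yes refl

Typing : ℕ → Set
Typing n = Fin n → VertexType

countVertices : ∀ {n} {P : Pred (Fin n) 0ℓ} → Decidable₁ P → ℕ
countVertices {n} P? = length (filter P? (allFin n))

IsAssignment : ∀ {n} → ℕ → Typing n → Set
IsAssignment {n} k P =
    countVertices (λ v → P v ≟ᵗ type₁) ≡ k
  × countVertices (λ v → P v ≟ᵗ type₂) ≡ n ∸ k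

module _ {n : ℕ} (G : Graph n) where
  open Graph G

  Integrated : Typing n → Fin n → Set
  Integrated P v = ∃[ u ] Adj v u × P u ≢ P v

  integrated? : ∀ P → Decidable₁ (Integrated P)
  integrated? P v = any? λ u → adj? v u ×-dec ¬? (P u ≟ᵗ P v)

  IoA : Typing n → ℕ
  IoA P = countVertices (integrated? P)

  IsOPT : ℕ → ℕ → Set
  IsOPT k opt =
      (∃[ P ] IsAssignment k P × IoA P ≡ opt)
    × (∀ P → IsAssignment k P → IoA P ≤ opt)

  exchange : Typing n → Fin n → Fin n → Typing n
  exchange P x y = P ∘ transpose x y

  ImprovingPair : Typing n → Fin n → Fin n → Set
  ImprovingPair P x y =
    P x ≡ type₁ × P y ≡ type₂ × IoA P < IoA (exchange P x y)

  data Step : Rel (Typing n) 0ℓ where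
    step : ∀ {P x y} → ImprovingPair P x y → Step P (exchange P x y)

  -- The initial assignment and the improving pair chosen in each round are
  -- arbitrary, so the algorithm is a relation between input and output.
  Returns : ℕ → Typing n → Set
  Returns k P =
    ∃[ P₀ ] IsAssignment k P₀ × Star Step P₀ P × (∀ x y → ¬ ImprovingPair P x y)

-- Call a vertex deprived if it is neither isolated nor integrated. At a local optimum,
-- deprived vertices have only one type: exchanging a deprived vertex with an unintegrated
-- one of the other type would destroy nothing and integrate it. If the deprived vertices
-- have type 1, all n − k ≥ n/2 vertices of type 2 are integrated. Otherwise let A and B be
-- the vertices of types 1 and 2, so that all of A is integrated, let D(w) be the set of
-- deprived vertices equal or adjacent to w, and let U(x) be the set of vertices whose only
-- neighbour of the other type is x. Exchanging x ∈ A with w ∈ B shows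
-- |D(w)| ≤ 1 + |U(x)| + |U(w)|, and the sets U(x) with x in A (or in B) are disjoint sets
-- of integrated vertices of the other type.
--
-- If U(x) = ∅ for some x ∈ A, then |D(w)| ≤ 1 + |U(w)|, and the sets D(w) with w integrated
-- cover the deprived vertices, so there are at most IoA(P) of these.
-- Otherwise let m = min |U(x)| over x ∈ A. Then |D(w)| ≤ 1 + m for every w: if U(w) contains
-- some x, then U(x) = {w} and U(w) = {x}, so that exchanging x and w destroys nothing. The
-- deprived vertices integrated by an optimal Q are covered by the D(w) with Q(w) = 1, so
-- there are at most k(1 + m) ≤ |A| + Σ |U(x)| ≤ IoA(P) of them.
module Submission where

open import Defs
import Algebra.Properties.Semiring.Sum
open import Data.Bool using (if_then_else_; true; false)
open import Data.Fin using (Fin; zero; suc)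
open import Data.Fin.Properties using (any?; all?; _≟_)
open import Data.Fin.Permutation.Components using (transpose)
open import Data.List using (allFin; filter; length; tabulate)
open import Data.List.Extrema.Nat using (argmin; argmin-all; f[argmin]≤f[xs])
open import Data.List.Membership.Propositional.Properties using (∈-filter⁺; ∈-allFin)
open import Data.List.Relation.Unary.All using (lookup)
open import Data.List.Relation.Unary.All.Properties using (all-filter)
open import Data.Nat using (ℕ; zero; suc; _+_; _*_; _∸_; _≤_; z≤n; s≤s)
open import Data.Nat.Properties
  using ( +-*-semiring; module ≤-Reasoning; ≤-trans; ≤-refl; ≤-reflexive; ≮⇒≥; ≰⇒>; ≤-pred; _≤?_
        ; +-mono-≤; +-monoˡ-≤; +-monoʳ-≤; *-monoʳ-≤; +-cancelˡ-≤; +-comm; +-identityʳ; *-identityˡ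
        ; m≤m+n; m≤n+m; n≤1+n; m≤n+m∸n; m+n≤o⇒m≤o∸n )
open import Data.Product using (∃-syntax; _×_; _,_; proj₁; proj₂)
open import Data.Sum using (_⊎_; inj₁; inj₂)
open import Function using (_∘_; id; case_of_)
open import Level using (0ℓ)
open import Relation.Binary.Construct.Closure.ReflexiveTransitive using (Star; ε; _◅_)
open import Relation.Binary.PropositionalEquality
  using (_≡_; _≢_; refl; sym; trans; cong; cong₂; subst; subst₂; ≢-sym)
open import Relation.Nullary using (¬_; Dec; yes; no; does; contradiction)
open import Relation.Nullary.Decidable using (_×-dec_; _→-dec_; _⊎-dec_; ¬?)
open import Relation.Unary using (Pred) renaming (Decidable to Decidable₁)
open Algebra.Properties.Semiring.Sum +-*-semiring
  using (sum; sum-cong-≗; ∑-distrib-+; ∑-comm; sum-permute; *-distribˡ-sum; *-distribʳ-sum; sum-replicate-zero)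
import Data.Fin.Permutation as Permutation

-- Counting vertices by sums of indicators.

𝟙 : {A : Set} → Dec A → ℕ
𝟙 d = if does d then 1 else 0

-- A sum of indicators, unlike the length of a filtered list, lets covering and disjointness be
-- checked termwise and double sums be swapped.
# : ∀ {n} {P : Pred (Fin n) 0ℓ} → Decidable₁ P → ℕ
# P? = sum λ v → 𝟙 (P? v)

𝟙-yes : {A : Set} (d : Dec A) → A → 𝟙 d ≡ 1
𝟙-yes (yes _) a = refl
𝟙-yes (no ¬a) a = contradiction a ¬a

1≤𝟙 : {A : Set} (d : Dec A) → A → 1 ≤ 𝟙 d
1≤𝟙 d a = ≤-reflexive (sym (𝟙-yes d a))

𝟙-× : {A B : Set} (d : Dec A) (e : Dec B) → 𝟙 d * 𝟙 e ≡ 𝟙 (d ×-dec e)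
𝟙-× (yes _) (yes _) = refl
𝟙-× (yes _) (no _)  = refl
𝟙-× (no _)  _       = refl

𝟙≤ : {A : Set} (d : Dec A) {m : ℕ} → (A → 1 ≤ m) → 𝟙 d ≤ m
𝟙≤ (yes a) h = h a
𝟙≤ (no _)  h = z≤n

length-filter-tabulate : ∀ {n m} {P : Pred (Fin m) 0ℓ} (P? : Decidable₁ P) (f : Fin n → Fin m) →
  length (filter P? (tabulate f)) ≡ sum λ i → 𝟙 (P? (f i))
length-filter-tabulate {zero}  P? f = refl
length-filter-tabulate {suc n} P? f with does (P? (f zero))
... | true  = cong suc (length-filter-tabulate P? (f ∘ suc))
... | false = length-filter-tabulate P? (f ∘ suc)

count≡# : ∀ {n} {P : Pred (Fin n) 0ℓ} (P? : Decidable₁ P) → countVertices P? ≡ # P?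
count≡# P? = length-filter-tabulate P? id

sum-mono-≤ : ∀ {n} {f g : Fin n → ℕ} → (∀ i → f i ≤ g i) → sum f ≤ sum g
sum-mono-≤ {zero}  h = z≤n
sum-mono-≤ {suc n} h = +-mono-≤ (h zero) (sum-mono-≤ (h ∘ suc))

sum≤0 : ∀ {n} {f : Fin n → ℕ} → (∀ i → f i ≤ 0) → sum f ≤ 0
sum≤0 {n} h = ≤-trans (sum-mono-≤ h) (≤-reflexive (sum-replicate-zero n))

term≤sum : ∀ {n} (f : Fin n → ℕ) i → f i ≤ sum f
term≤sum f zero    = m≤m+n _ _
term≤sum f (suc i) = ≤-trans (term≤sum (f ∘ suc) i) (m≤n+m _ _)

#≤n : ∀ {n} {P : Pred (Fin n) 0ℓ} (P? : Decidable₁ P) → # P? ≤ n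
#≤n {zero}  P? = z≤n
#≤n {suc n} P? = +-mono-≤ (𝟙≤ (P? zero) (λ _ → ≤-refl)) (#≤n (P? ∘ suc))

#-singleton : ∀ {n} (i : Fin n) → # (_≟ i) ≡ 1
#-singleton {suc n} zero = cong suc (sum-replicate-zero n)
#-singleton (suc i)      = #-singleton i

module _ {n} {P : Pred (Fin n) 0ℓ} (P? : Decidable₁ P) where

  #-mono : {Q : Pred (Fin n) 0ℓ} (Q? : Decidable₁ Q) → (∀ v → P v → Q v) → # P? ≤ # Q?
  #-mono Q? h = sum-mono-≤ λ v → 𝟙≤ (P? v) λ p → 1≤𝟙 (Q? v) (h v p)

  #-empty : (∀ v → ¬ P v) → # P? ≤ 0
  #-empty h = sum≤0 λ v → 𝟙≤ (P? v) λ p → contradiction p (h v)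

  #-inhabited : 1 ≤ # P? → ∃[ v ] P v
  #-inhabited pos with any? P?
  ... | yes p = p
  ... | no ¬p = contradiction (≤-trans pos (#-empty λ v p → ¬p (v , p))) λ ()

  -- The bound on `m` is asked for only when a witness exists, so that `m` can itself be an
  -- indicator.
  #-unique : ∀ {m} → (∀ {i j} → P i → P j → i ≡ j) → (∀ {i} → P i → 1 ≤ m) → # P? ≤ m
  #-unique uniq bound with any? P?
  ... | yes (i , p) = ≤-trans (#-mono (_≟ i) λ _ q → uniq q p)
                        (≤-trans (≤-reflexive (#-singleton i)) (bound p))
  ... | no ¬p       = ≤-trans (#-empty λ v p → ¬p (v , p)) z≤n

  two≤# : ∀ {i j} → i ≢ j → P i → P j → 2 ≤ # P?
  two≤# {i} {j} i≢j pi pj = begin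
    2                                  ≡⟨ cong₂ _+_ (#-singleton i) (#-singleton j) ⟨
    # (_≟ i) + # (_≟ j)                ≡⟨ ∑-distrib-+ (λ v → 𝟙 (v ≟ i)) (λ v → 𝟙 (v ≟ j)) ⟨
    sum (λ v → 𝟙 (v ≟ i) + 𝟙 (v ≟ j))  ≤⟨ sum-mono-≤ term ⟩
    # P?                               ∎
    where
    open ≤-Reasoning
    term : ∀ v → 𝟙 (v ≟ i) + 𝟙 (v ≟ j) ≤ 𝟙 (P? v)
    term v with v ≟ i | v ≟ j
    ... | yes refl | yes refl = contradiction refl i≢j
    ... | yes refl | no _     = 1≤𝟙 (P? v) pi
    ... | no _     | yes refl = 1≤𝟙 (P? v) pj
    ... | no _     | no _     = z≤n

minimiser : ∀ {n} {P : Pred (Fin n) 0ℓ} → Decidable₁ P → (f : Fin n → ℕ) →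
  ∃[ x ] P x → ∃[ x ] P x × (∀ y → P y → f x ≤ f y)
minimiser {n} P? f (x , px) =
    argmin f x xs
  , argmin-all f px (all-filter P? (allFin n))
  , λ y py → lookup (f[argmin]≤f[xs] x xs) (∈-filter⁺ P? (∈-allFin y) py)
  where xs = filter P? (allFin n)

-- The two types, and exchanging two vertices.

≢-two : ∀ {a b c : VertexType} → a ≢ c → b ≢ c → a ≡ b
≢-two {type₁} {type₁} _ _ = refl
≢-two {type₂} {type₂} _ _ = refl
≢-two {type₁} {type₂} {type₁} p _ = contradiction refl p
≢-two {type₁} {type₂} {type₂} _ q = contradiction refl q
≢-two {type₂} {type₁} {type₁} _ q = contradiction refl q
≢-two {type₂} {type₁} {type₂} p _ = contradiction refl p

≡-stable : ∀ {a b : VertexType} → ¬ (a ≢ b) → a ≡ b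
≡-stable {a} {b} h with a ≟ᵗ b
... | yes e = e
... | no ¬e = contradiction ¬e h

≢type₁ : ∀ {a} → a ≢ type₁ → a ≡ type₂
≢type₁ h = ≢-two h λ ()

-- Only the values of the exchanged typing are kept, in a form symmetric in the two vertices: facts
-- proved for one end transfer to the other through `swapped-sym`.
record Swapped {n} (P Q : Typing n) (x y : Fin n) : Set where
  field
    at-x  : Q x ≡ P y
    at-y  : Q y ≡ P x
    other : ∀ {v} → v ≢ x → v ≢ y → Q v ≡ P v
    mixed : P x ≢ P y

swapped-sym : ∀ {n} {P Q : Typing n} {x y} → Swapped P Q x y → Swapped P Q y x
swapped-sym s = record
  { at-x = at-y ; at-y = at-x ; other = λ p q → other q p ; mixed = ≢-sym mixed }
  where open Swapped s

exchange-swapped : ∀ {n} (G : Graph n) (P : Typing n) {x y} → P x ≢ P y →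
  Swapped P (exchange G P x y) x y
exchange-swapped G P {x} {y} x≢y = record
  { at-x = cong P left ; at-y = cong P right ; other = λ p q → cong P (fixed p q) ; mixed = x≢y }
  where
  left : transpose x y x ≡ y
  left with x ≟ x
  ... | yes _ = refl
  ... | no ¬e = contradiction refl ¬e
  right : transpose x y y ≡ x
  right with y ≟ x
  ... | yes e = e
  ... | no _ with y ≟ y
  ...   | yes _ = refl
  ...   | no ¬e = contradiction refl ¬e
  fixed : ∀ {v} → v ≢ x → v ≢ y → transpose x y v ≡ v
  fixed {v} p q with v ≟ x
  ... | yes e = contradiction e p
  ... | no _ with v ≟ y
  ...   | yes e = contradiction e q
  ...   | no _ = refl

countType-exchange : ∀ {n} (G : Graph n) (P : Typing n) x y t →
  # (λ v → exchange G P x y v ≟ᵗ t) ≡ # (λ v → P v ≟ᵗ t)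
countType-exchange G P x y t =
  sym (sum-permute (λ v → 𝟙 (P v ≟ᵗ t)) (Permutation.transpose x y))

-- Each exchange permutes the vertices, so a run from an assignment ends in an assignment for the
-- same `k`.
countType-run : ∀ {n} (G : Graph n) {P Q : Typing n} → Star (Step G) P Q → ∀ t →
  # (λ v → Q v ≟ᵗ t) ≡ # (λ v → P v ≟ᵗ t)
countType-run G ε t = refl
countType-run G (step {P} {x} {y} _ ◅ run) t =
  trans (countType-run G run t) (countType-exchange G P x y t)

-- Deprived vertices and sole supports.

module _ {n : ℕ} (G : Graph n) where
  open Graph G

  -- The condition `u ≢ v` discounts loops, which can integrate no vertex.
  NonIsolated : Pred (Fin n) 0ℓ
  NonIsolated v = ∃[ u ] Adj v u × u ≢ v

  nonIsolated? : Decidable₁ NonIsolated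
  nonIsolated? v = any? λ u → adj? v u ×-dec ¬? (u ≟ v)

  integrated⇒nonIsolated : ∀ {P v} → Integrated G P v → NonIsolated v
  integrated⇒nonIsolated {P} (u , vu , d) = u , vu , λ e → d (cong P e)

  IoA≡# : ∀ P → IoA G P ≡ # (integrated? G P)
  IoA≡# P = count≡# (integrated? G P)

  module _ (P : Typing n) where

    private
      Int : Pred (Fin n) 0ℓ
      Int = Integrated G P
      int? : Decidable₁ Int
      int? = integrated? G P

    Deprived : Pred (Fin n) 0ℓ
    Deprived v = NonIsolated v × ¬ Int v

    deprived? : Decidable₁ Deprived
    deprived? v = nonIsolated? v ×-dec ¬? (int? v)

    -- The set D(w), the possible gains when `w` changes type.
    DeprivedNear : Fin n → Pred (Fin n) 0ℓ
    DeprivedNear w v = Deprived v × (v ≡ w ⊎ Adj w v)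

    deprivedNear? : ∀ w → Decidable₁ (DeprivedNear w)
    deprivedNear? w v = deprived? v ×-dec ((v ≟ w) ⊎-dec adj? w v)

    -- The set U(x), the vertices that may lose integration because `x` changes type.
    SoleSupport : Fin n → Pred (Fin n) 0ℓ
    SoleSupport x v = Adj v x × P x ≢ P v × (∀ z → Adj v z → P z ≢ P v → z ≡ x)

    soleSupport? : ∀ x → Decidable₁ (SoleSupport x)
    soleSupport? x v = adj? v x ×-dec ¬? (P x ≟ᵗ P v) ×-dec
      all? λ z → adj? v z →-dec (¬? (P z ≟ᵗ P v) →-dec (z ≟ x))

    same-type : ∀ {v u} → ¬ Int v → Adj v u → P u ≡ P v
    same-type ¬int vu = ≡-stable λ d → ¬int (_ , vu , d)

    other-support : ∀ {x v} → Adj v x → P x ≢ P v → ¬ SoleSupport x v →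
      ∃[ z ] Adj v z × P z ≢ P v × z ≢ x
    other-support {x} {v} vx d ¬sole
      with any? (λ z → adj? v z ×-dec ¬? (P z ≟ᵗ P v) ×-dec ¬? (z ≟ x))
    ... | yes h = h
    ... | no ¬h = contradiction (vx , d , only) ¬sole
      where
      only : ∀ z → Adj v z → P z ≢ P v → z ≡ x
      only z vz dz with z ≟ x
      ... | yes e = e
      ... | no ¬e = contradiction (z , vz , dz , ¬e) ¬h

    -- Effect of an exchange on integration.

    module _ {Q : Typing n} {x w : Fin n} (s : Swapped P Q x w) where
      open Swapped s

      private
        avoids : ∀ {a b v} → P a ≢ P b → P v ≡ P b → v ≢ a
        avoids d e refl = d e

      -- A neighbour integrating `v` keeps its type unless it is `x` or `w`. In that case `v` has a
      -- second neighbour of the same type, which cannot be the other exchanged vertex because `x`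
      -- and `w` differ in type.
      integrated-kept : ∀ {v} → v ≢ x → v ≢ w → Int v →
        ¬ SoleSupport x v → ¬ SoleSupport w v → Integrated G Q v
      integrated-kept {v} v≢x v≢w (u , vu , d) ¬sx ¬sw with u ≟ x | u ≟ w
      ... | yes refl | _ =
        let z , vz , dz , z≢x = other-support vu d ¬sx
        in z , vz , λ e → dz (trans (sym (other z≢x (avoids (≢-sym mixed) (≢-two dz d)))) (trans e (other v≢x v≢w)))
      ... | no _ | yes refl =
        let z , vz , dz , z≢w = other-support vu d ¬sw
        in z , vz , λ e → dz (trans (sym (other (avoids mixed (≢-two dz d)) z≢w)) (trans e (other v≢x v≢w)))
      ... | no u≢x | no u≢w =
        u , vu , λ e → d (trans (sym (other u≢x u≢w)) (trans e (other v≢x v≢w)))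

      integrated-x : Adj x w → Integrated G Q x
      integrated-x xw = w , xw , λ e → mixed (trans (sym at-y) (trans e at-x))

      integrated-w : ∀ {v} → Adj w v → v ≢ w → P v ≡ P w → Integrated G Q w
      integrated-w {v} wv v≢w e = v , wv , λ e′ →
        mixed (trans (sym at-y) (trans (sym e′) (trans (other (avoids mixed e) v≢w) e)))

      -- All neighbours of a deprived vertex share its type. If `v` is `w`, it leaves that type
      -- while some neighbour keeps it; otherwise its neighbour `w` leaves it while `v` keeps it.
      integrated-gained : ∀ {v} → P v ≡ P w → DeprivedNear w v → Integrated G Q v
      integrated-gained {v} e (((u , vu , u≢v) , ¬int) , near) with v ≟ w
      ... | yes refl = integrated-w vu u≢v (same-type ¬int vu)
      ... | no v≢w with near
      ...   | inj₁ v≡w = contradiction v≡w v≢w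
      ...   | inj₂ wv  = w , adj-sym wv , λ e′ →
        mixed (trans (sym at-y) (trans e′ (trans (other (avoids mixed e) v≢w) e)))

    -- Consequences of local optimality.

    module _ (locallyOptimal : ∀ x y → ¬ ImprovingPair G P x y) where

      -- The exchange does not raise `IoA`, so the gains `R` are at most the losses. `L` is a weight
      -- rather than a set, so that several causes of loss can be added up.
      gains≤losses : ∀ {x y} → P x ≡ type₁ → P y ≡ type₂ →
        {R : Pred (Fin n) 0ℓ} (R? : Decidable₁ R) (L : Fin n → ℕ) →
        (∀ v → R v → ¬ Int v) → (∀ v → R v → Integrated G (exchange G P x y) v) →
        (∀ v → Int v → Integrated G (exchange G P x y) v ⊎ 1 ≤ L v) →
        # R? ≤ sum L
      gains≤losses {x} {y} px py R? L new gained kept = +-cancelˡ-≤ (# int?) _ _ (begin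
        # int? + # R?                            ≡⟨ ∑-distrib-+ (λ v → 𝟙 (int? v)) (λ v → 𝟙 (R? v)) ⟨
        sum (λ v → 𝟙 (int? v) + 𝟙 (R? v))        ≤⟨ sum-mono-≤ term ⟩
        sum (λ v → 𝟙 (int?′ v) + L v)            ≡⟨ ∑-distrib-+ (λ v → 𝟙 (int?′ v)) L ⟩
        # int?′ + sum L                          ≤⟨ +-monoˡ-≤ (sum L) noGain ⟩
        # int? + sum L                           ∎)
        where
        open ≤-Reasoning
        int?′ = integrated? G (exchange G P x y)
        noGain : # int?′ ≤ # int?
        noGain = subst (_≤ # int?) (IoA≡# _) (subst (IoA G _ ≤_) (IoA≡# P)
          (≮⇒≥ λ lt → locallyOptimal x y (px , py , lt)))
        one : ∀ {v} → Integrated G (exchange G P x y) v → 1 ≤ 𝟙 (int?′ v) + L v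
        one {v} i = ≤-trans (1≤𝟙 (int?′ v) i) (m≤m+n _ _)
        term : ∀ v → 𝟙 (int? v) + 𝟙 (R? v) ≤ 𝟙 (int?′ v) + L v
        term v with int? v | R? v
        ... | yes i | yes r = contradiction i (new v r)
        ... | no _  | no _  = z≤n
        ... | no _  | yes r = one (gained v r)
        ... | yes i | no _ with kept v i
        ...   | inj₁ i′ = one i′
        ...   | inj₂ l  = ≤-trans l (m≤n+m _ _)

      type₁≢type₂ : ∀ {x y} → P x ≡ type₁ → P y ≡ type₂ → P x ≢ P y
      type₁≢type₂ px py e with trans (sym px) (trans e py)
      ... | ()

      swap : ∀ {x y} → P x ≡ type₁ → P y ≡ type₂ → Swapped P (exchange G P x y) x y
      swap px py = exchange-swapped G P (type₁≢type₂ px py)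

      -- An unintegrated vertex is nobody's sole support, since the supported vertex would integrate
      -- it in turn. The exchange therefore loses nothing, and the single gain `z` would improve
      -- `IoA`.
      unintegrated-pair⇒gain-impossible : ∀ {x y z} → P x ≡ type₁ → P y ≡ type₂ →
        ¬ Int x → ¬ Int y → Deprived z → ¬ Integrated G (exchange G P x y) z
      unintegrated-pair⇒gain-impossible {x} {y} {z} px py ¬x ¬y dz gain =
        contradiction (subst (_≤ 0) (#-singleton z)
          (≤-trans (gains≤losses px py (_≟ z) (λ _ → 0)
            (λ { _ refl → proj₂ dz }) (λ { _ refl → gain })
            λ v i → inj₁ (integrated-kept (swap px py)
              (λ { refl → ¬x i }) (λ { refl → ¬y i }) i (noSupport ¬x) (noSupport ¬y)))
            (sum≤0 {n} λ _ → z≤n)))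
          λ ()
        where
        noSupport : ∀ {a v} → ¬ Int a → ¬ SoleSupport a v
        noSupport ¬a (va , d , _) = ¬a (_ , adj-sym va , ≢-sym d)

      -- Exchanging `x` with an unintegrated `y` would integrate `x`; `swapped-sym` puts `x` in the
      -- place of the gaining vertex `w`.
      deprived₁⇒type₂-integrated : ∀ {x} → Deprived x → P x ≡ type₁ → ∀ y → P y ≡ type₂ → Int y
      deprived₁⇒type₂-integrated {x} dx px y py with int? y
      ... | yes i = i
      ... | no ¬i = contradiction
        (integrated-gained (swapped-sym (swap px py)) refl (dx , inj₁ refl))
        (unintegrated-pair⇒gain-impossible px py (proj₂ dx) ¬i dx)

      deprived₂⇒type₁-integrated : ∀ {y} → Deprived y → P y ≡ type₂ → ∀ x → P x ≡ type₁ → Int x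
      deprived₂⇒type₁-integrated {y} dy py x px with int? x
      ... | yes i = i
      ... | no ¬i = contradiction
        (integrated-gained (swap px py) refl (dy , inj₁ refl))
        (unintegrated-pair⇒gain-impossible px py ¬i (proj₂ dy) dy)

      -- The case of all type-1 vertices integrated.

      module _ (allInt : ∀ x → P x ≡ type₁ → Int x) where

        deprived⇒type₂ : ∀ {v} → Deprived v → P v ≡ type₂
        deprived⇒type₂ dv = ≢type₁ λ e → proj₂ dv (allInt _ e)

        -- Such a `w` is itself integrated, and it integrates every neighbour of type 2, the type of
        -- all deprived vertices.
        deprivedNear-type₁ : ∀ {w} → P w ≡ type₁ → # (deprivedNear? w) ≤ 0
        deprivedNear-type₁ {w} pw = #-empty (deprivedNear? w) λ where
          v (dv , inj₁ refl) → proj₂ dv (allInt _ pw)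
          v (dv , inj₂ wv)   → type₁≢type₂ pw (deprived⇒type₂ dv)
                                 (same-type (proj₂ dv) (adj-sym wv))

        gained : ∀ {x w} → P x ≡ type₁ → P w ≡ type₂ →
          ∀ v → DeprivedNear w v → Integrated G (exchange G P x w) v
        gained px pw v near =
          integrated-gained (swap px pw) (trans (deprived⇒type₂ (proj₁ near)) (sym pw)) near

        -- Exchanging `x` and `w` gains D(w) and can lose only `x` itself, U(x) and U(w).
        deprivedNear≤ : ∀ {x w} → P x ≡ type₁ → P w ≡ type₂ →
          # (deprivedNear? w) ≤ 1 + (# (soleSupport? x) + # (soleSupport? w))
        deprivedNear≤ {x} {w} px pw with any? (deprivedNear? w)
        ... | no none = ≤-trans (#-empty (deprivedNear? w) λ v near → none (v , near)) z≤n
        ... | yes (u , near@(du , _)) = ≤-trans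
          (gains≤losses px pw (deprivedNear? w) L (λ _ → proj₂ ∘ proj₁) (gained px pw) (kept (swap px pw)))
          (≤-reflexive (trans (∑-distrib-+ (λ v → 𝟙 (v ≟ x)) _)
            (cong₂ _+_ (#-singleton x) (∑-distrib-+ (λ v → 𝟙 (soleSupport? x v)) _))))
          where
          L : Fin n → ℕ
          L v = 𝟙 (v ≟ x) + (𝟙 (soleSupport? x v) + 𝟙 (soleSupport? w v))
          -- `w` costs nothing: as D(w) is inhabited, either `w` was unintegrated or it has a
          -- deprived neighbour `u` that keeps the old type of `w`.
          w-kept : ∀ {Q} → Swapped P Q x w → Int w → Integrated G Q w
          w-kept s i with near
          ... | _ , inj₁ refl = contradiction i (proj₂ du)
          ... | _ , inj₂ wu   = integrated-w s wu (λ { refl → proj₂ du i })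
                                  (trans (deprived⇒type₂ du) (sym pw))
          kept : ∀ {Q} → Swapped P Q x w → ∀ v → Int v → Integrated G Q v ⊎ 1 ≤ L v
          kept s v i with v ≟ x | v ≟ w | soleSupport? x v | soleSupport? w v
          ... | yes _  | _        | _      | _      = inj₂ (s≤s z≤n)
          ... | no _   | yes refl | _      | _      = inj₁ (w-kept s i)
          ... | no _   | no _     | yes sx | _      =
            inj₂ (≤-trans (1≤𝟙 (soleSupport? x v) sx) (m≤m+n _ _))
          ... | no _   | no _     | no _   | yes sw =
            inj₂ (≤-trans (1≤𝟙 (soleSupport? w v) sw) (m≤n+m _ _))
          ... | no v≢x | no v≢w   | no ¬sx | no ¬sw =
            inj₁ (integrated-kept s v≢x v≢w i ¬sx ¬sw)

        -- `x` and `w` go on integrating each other. Neither has a further neighbour of the opposite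
        -- type, so neither supports a third vertex and the exchange loses nothing.
        mutualSupport⇒noDeprivedNear : ∀ {x w} → P x ≡ type₁ → P w ≡ type₂ →
          SoleSupport w x → SoleSupport x w → # (deprivedNear? w) ≤ 0
        mutualSupport⇒noDeprivedNear {x} {w} px pw (xw , _ , only-w) (_ , _ , only-x) = ≤-trans
          (gains≤losses px pw (deprivedNear? w) (λ _ → 0) (λ _ → proj₂ ∘ proj₁) (gained px pw)
            λ v i → inj₁ (kept (swap px pw) v i))
          (sum≤0 {n} λ _ → z≤n)
          where
          kept : ∀ {Q} → Swapped P Q x w → ∀ v → Int v → Integrated G Q v
          kept s v i with v ≟ x | v ≟ w
          ... | yes refl | _        = integrated-x s xw
          ... | no _     | yes refl = integrated-x (swapped-sym s) (adj-sym xw)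
          ... | no v≢x   | no v≢w   = integrated-kept s v≢x v≢w i
            (λ (vx , d , _) → v≢w (only-w v (adj-sym vx) (≢-sym d)))
            (λ (vw , d , _) → v≢x (only-x v (adj-sym vw) (≢-sym d)))

        -- A union bound: a vertex integrated by `Q` is not isolated, so it is integrated by `P` or
        -- deprived, and then lies in some D(w) with `w` in `S`.
        covering-bound : ∀ Q {S : Pred (Fin n) 0ℓ} (S? : Decidable₁ S) →
          (∀ v → Deprived v → Integrated G Q v → ∃[ w ] S w × DeprivedNear w v) →
          IoA G Q ≤ IoA G P + sum (λ w → 𝟙 (S? w) * # (deprivedNear? w))
        covering-bound Q S? cover = begin
          IoA G Q                                                  ≡⟨ IoA≡# Q ⟩
          # int?′                                                  ≤⟨ sum-mono-≤ term ⟩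
          sum (λ v → 𝟙 (int? v) + sum (λ w → near w v))            ≡⟨ ∑-distrib-+ (λ v → 𝟙 (int? v)) _ ⟩
          # int? + sum (λ v → sum (λ w → near w v))                ≡⟨ cong₂ _+_ (sym (IoA≡# P)) (∑-comm (λ v w → near w v)) ⟩
          IoA G P + sum (λ w → sum (near w))
            ≡⟨ cong (IoA G P +_) (sum-cong-≗ λ w →
                 sym (*-distribˡ-sum (𝟙 (S? w)) λ v → 𝟙 (deprivedNear? w v))) ⟩
          IoA G P + sum (λ w → 𝟙 (S? w) * # (deprivedNear? w))     ∎
          where
          open ≤-Reasoning
          int?′ = integrated? G Q
          near : Fin n → Fin n → ℕ
          near w v = 𝟙 (S? w) * 𝟙 (deprivedNear? w v)
          term : ∀ v → 𝟙 (int?′ v) ≤ 𝟙 (int? v) + sum (λ w → near w v)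
          term v = 𝟙≤ (int?′ v) λ i′ → case int? v of λ where
            (yes i) → ≤-trans (1≤𝟙 (int? v) i) (m≤m+n _ _)
            (no ¬i) →
              let w , sw , nw = cover v (integrated⇒nonIsolated i′ , ¬i) i′ in
              ≤-trans (≤-reflexive (sym (cong₂ _*_ (𝟙-yes (S? w) sw) (𝟙-yes (deprivedNear? w v) nw))))
                (≤-trans (term≤sum (λ w → near w v) w) (m≤n+m _ (𝟙 (int? v))))

        integratedOf? : ∀ t → Decidable₁ (λ v → P v ≡ t × Int v)
        integratedOf? t v = (P v ≟ᵗ t) ×-dec int? v

        integrated-split : # (integratedOf? type₁) + # (integratedOf? type₂) ≤ IoA G P
        integrated-split = begin
          # (integratedOf? type₁) + # (integratedOf? type₂)
            ≡⟨ ∑-distrib-+ (λ v → 𝟙 (integratedOf? type₁ v)) _ ⟨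
          sum (λ v → 𝟙 (integratedOf? type₁ v) + 𝟙 (integratedOf? type₂ v))
            ≤⟨ sum-mono-≤ term ⟩
          # int?
            ≡⟨ IoA≡# P ⟨
          IoA G P ∎
          where
          open ≤-Reasoning
          term : ∀ v → 𝟙 (integratedOf? type₁ v) + 𝟙 (integratedOf? type₂ v) ≤ 𝟙 (int? v)
          term v with P v | int? v
          ... | type₁ | yes _ = ≤-refl
          ... | type₁ | no _  = z≤n
          ... | type₂ | yes _ = ≤-refl
          ... | type₂ | no _  = z≤n

        -- Double counting by columns: a vertex has at most one sole support, and having one makes
        -- it integrated and of the opposite type.
        soleSupports≤ : ∀ t t′ → t ≢ t′ →
          sum (λ x → 𝟙 (P x ≟ᵗ t) * # (soleSupport? x)) ≤ # (integratedOf? t′)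
        soleSupports≤ t t′ t≢t′ = begin
          sum (λ x → 𝟙 (P x ≟ᵗ t) * # (soleSupport? x))
            ≡⟨ sum-cong-≗ (λ x → *-distribˡ-sum (𝟙 (P x ≟ᵗ t)) λ v → 𝟙 (soleSupport? x v)) ⟩
          sum (λ x → sum (λ v → 𝟙 (P x ≟ᵗ t) * 𝟙 (soleSupport? x v)))
            ≡⟨ ∑-comm (λ x v → 𝟙 (P x ≟ᵗ t) * 𝟙 (soleSupport? x v)) ⟩
          sum (λ v → sum (λ x → 𝟙 (P x ≟ᵗ t) * 𝟙 (soleSupport? x v)))
            ≤⟨ sum-mono-≤ (λ v → ≤-trans
                 (≤-reflexive (sum-cong-≗ λ x → 𝟙-× (P x ≟ᵗ t) (soleSupport? x v)))
                 (column v)) ⟩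
          # (integratedOf? t′) ∎
          where
          open ≤-Reasoning
          both? : ∀ v → Decidable₁ (λ x → P x ≡ t × SoleSupport x v)
          both? v x = (P x ≟ᵗ t) ×-dec soleSupport? x v
          column : ∀ v → # (both? v) ≤ 𝟙 (integratedOf? t′ v)
          column v = #-unique (both? v)
            (λ { (_ , vi , di , _) (_ , _ , _ , only) → only _ vi di })
            λ { (refl , vx , d , _) → 1≤𝟙 (integratedOf? t′ v)
              (≢-two (≢-sym d) (≢-sym t≢t′) , _ , vx , d) }

        -- Here |D(w)| ≤ 1 + |U(w)| for `w` of type 2. Summed over the integrated `w`, the ones
        -- count integrated vertices of type 2, and the sets U(w) consist of integrated vertices of
        -- type 1.
        freeSwap-bound : ∀ {x} → P x ≡ type₁ → # (soleSupport? x) ≤ 0 →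
          ∀ Q → IoA G Q ≤ IoA G P + IoA G P
        freeSwap-bound {x} px free Q = ≤-trans (covering-bound Q int? λ v dv _ → cover dv)
          (+-monoʳ-≤ (IoA G P) (begin
            sum (λ w → 𝟙 (int? w) * # (deprivedNear? w))
              ≤⟨ sum-mono-≤ term ⟩
            sum (λ w → 𝟙 (integratedOf? type₂ w) + 𝟙 (P w ≟ᵗ type₂) * # (soleSupport? w))
              ≡⟨ ∑-distrib-+ (λ w → 𝟙 (integratedOf? type₂ w)) _ ⟩
            # (integratedOf? type₂) + sum (λ w → 𝟙 (P w ≟ᵗ type₂) * # (soleSupport? w))
              ≤⟨ +-monoʳ-≤ _ (soleSupports≤ type₂ type₁ λ ()) ⟩
            # (integratedOf? type₂) + # (integratedOf? type₁)
              ≡⟨ +-comm (# (integratedOf? type₂)) _ ⟩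
            # (integratedOf? type₁) + # (integratedOf? type₂)
              ≤⟨ integrated-split ⟩
            IoA G P ∎))
          where
          open ≤-Reasoning
          near≤ : ∀ {w} → P w ≡ type₂ → # (deprivedNear? w) ≤ 1 + # (soleSupport? w)
          near≤ {w} pw = ≤-trans (deprivedNear≤ px pw)
            (s≤s (+-monoˡ-≤ (# (soleSupport? w)) free))
          cover : ∀ {v} → Deprived v → ∃[ w ] Int w × DeprivedNear w v
          cover {v} dv@((u , vu , u≢v) , ¬i) with int? u
          ... | yes iu = u , iu , dv , inj₂ (adj-sym vu)
          -- Were `u` unintegrated, D(v) would contain both `u` and `v`, yet |D(v)| ≤ 1 because the
          -- unintegrated `v` supports nothing.
          ... | no ¬iu = contradiction
            (≤-trans (two≤# (deprivedNear? v) u≢v (du , inj₂ vu) (dv , inj₁ refl))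
              (≤-trans (near≤ (deprived⇒type₂ dv)) (s≤s noSupport)))
            (λ { (s≤s ()) })
            where
            du : Deprived u
            du = (v , adj-sym vu , ≢-sym u≢v) , ¬iu
            noSupport : # (soleSupport? v) ≤ 0
            noSupport = #-empty (soleSupport? v) λ z (zv , d , _) →
              ¬i (z , adj-sym zv , ≢-sym d)
          term : ∀ w → 𝟙 (int? w) * # (deprivedNear? w) ≤
            𝟙 (integratedOf? type₂ w) + 𝟙 (P w ≟ᵗ type₂) * # (soleSupport? w)
          term w = split (P w ≟ᵗ type₂) (int? w) near≤ λ ¬pw → deprivedNear-type₁ (≢-two ¬pw λ ())
            where
            split : {T I : Set} (t : Dec T) (i : Dec I) {d u : ℕ} → (T → d ≤ 1 + u) → (¬ T → d ≤ 0) →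
              𝟙 i * d ≤ 𝟙 (t ×-dec i) + 𝟙 t * u
            split (yes t) (yes _) {d} {u} h _ = subst₂ _≤_ (sym (*-identityˡ d))
                                                  (cong suc (sym (*-identityˡ u))) (h t)
            split (no ¬t) (yes _) {d} _ h     = ≤-trans (≤-reflexive (*-identityˡ d)) (h ¬t)
            split _       (no _)  _ _         = z≤n

        -- `Q` has as many type-1 vertices as `P`, so the cost `1 + m` can be charged to those of
        -- `P` instead: each such `x` pays 1 as an integrated vertex and `m` out of U(x).
        uniform-bound : ∀ m → (∀ w → # (deprivedNear? w) ≤ 1 + m) →
          (∀ x → P x ≡ type₁ → m ≤ # (soleSupport? x)) →
          ∀ Q → # (λ v → Q v ≟ᵗ type₁) ≡ # (λ v → P v ≟ᵗ type₁) → IoA G Q ≤ IoA G P + IoA G P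
        uniform-bound m near≤ support≥ Q same = ≤-trans (covering-bound Q Q₁? cover)
          (+-monoʳ-≤ (IoA G P) (begin
            sum (λ w → 𝟙 (Q₁? w) * # (deprivedNear? w))
              ≤⟨ sum-mono-≤ (λ w → *-monoʳ-≤ (𝟙 (Q₁? w)) (near≤ w)) ⟩
            sum (λ w → 𝟙 (Q₁? w) * (1 + m))
              ≡⟨ *-distribʳ-sum (1 + m) (λ w → 𝟙 (Q₁? w)) ⟨
            # Q₁? * (1 + m)
              ≡⟨ cong (_* (1 + m)) same ⟩
            # P₁? * (1 + m)
              ≡⟨ *-distribʳ-sum (1 + m) (λ w → 𝟙 (P₁? w)) ⟩
            sum (λ x → 𝟙 (P₁? x) * (1 + m))
              ≤⟨ sum-mono-≤ term ⟩
            sum (λ x → 𝟙 (integratedOf? type₁ x) + 𝟙 (P₁? x) * # (soleSupport? x))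
              ≡⟨ ∑-distrib-+ (λ x → 𝟙 (integratedOf? type₁ x)) _ ⟩
            # (integratedOf? type₁) + sum (λ x → 𝟙 (P₁? x) * # (soleSupport? x))
              ≤⟨ +-monoʳ-≤ _ (soleSupports≤ type₁ type₂ λ ()) ⟩
            # (integratedOf? type₁) + # (integratedOf? type₂)
              ≤⟨ integrated-split ⟩
            IoA G P ∎))
          where
          open ≤-Reasoning
          Q₁? = λ v → Q v ≟ᵗ type₁
          P₁? = λ v → P v ≟ᵗ type₁
          cover : ∀ v → Deprived v → Integrated G Q v → ∃[ w ] Q w ≡ type₁ × DeprivedNear w v
          cover v dv (u , vu , d) with Q v ≟ᵗ type₁
          ... | yes e = v , e , dv , inj₁ refl
          ... | no ¬e = u , ≢-two d (≢-sym ¬e) , dv , inj₂ (adj-sym vu)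
          term : ∀ x → 𝟙 (P₁? x) * (1 + m) ≤
            𝟙 (integratedOf? type₁ x) + 𝟙 (P₁? x) * # (soleSupport? x)
          term x = split (P₁? x) (int? x) (allInt x) (support≥ x)
            where
            split : {T I : Set} (t : Dec T) (i : Dec I) {u : ℕ} → (T → I) → (T → m ≤ u) →
              𝟙 t * (1 + m) ≤ 𝟙 (t ×-dec i) + 𝟙 t * u
            split (no _)  _       _ _ = z≤n
            split (yes t) (no ¬i) f _ = contradiction (f t) ¬i
            split (yes t) (yes _) _ h = s≤s (+-monoˡ-≤ 0 (h t))

        type₁-integrated-bound : ∀ Q → # (λ v → Q v ≟ᵗ type₁) ≡ # (λ v → P v ≟ᵗ type₁) →
          IoA G Q ≤ IoA G P + IoA G P
        type₁-integrated-bound with any? (λ x → P x ≟ᵗ type₁)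
        -- Here k = 0; n serves as m because the lower bound on support is vacuous.
        ... | no none = uniform-bound n
          (λ w → ≤-trans (#≤n (deprivedNear? w)) (n≤1+n n)) (λ x px → contradiction (x , px) none)
        ... | yes some with minimiser (λ x → P x ≟ᵗ type₁) (λ x → # (soleSupport? x)) some
        ...   | x₀ , px₀ , least with 1 ≤? # (soleSupport? x₀)
        ...     | no ¬pos = λ Q _ → freeSwap-bound px₀ (≤-pred (≰⇒> ¬pos)) Q
        ...     | yes pos = uniform-bound _ near≤ least
          where
          near≤ : ∀ w → # (deprivedNear? w) ≤ 1 + # (soleSupport? x₀)
          near≤ w with P w ≟ᵗ type₁
          ... | yes pw = ≤-trans (deprivedNear-type₁ pw) z≤n
          ... | no ¬pw with any? (soleSupport? w)
          ...   | no none = ≤-trans (deprivedNear≤ px₀ (≢type₁ ¬pw))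
            (s≤s (≤-trans (+-monoʳ-≤ (# (soleSupport? x₀))
              (#-empty (soleSupport? w) λ v s → none (v , s))) (≤-reflexive (+-identityʳ _))))
          ...   | yes (x , s@(xw , d , only)) = ≤-trans (mutualSupport⇒noDeprivedNear px (≢type₁ ¬pw) s back) z≤n
            where
            px : P x ≡ type₁
            px = ≢-two (≢-sym d) (≢-sym ¬pw)
            back : SoleSupport x w
            back with #-inhabited (soleSupport? x) (≤-trans pos (least x px))
            ... | v , sv@(vx , d′ , _) with only v (adj-sym vx) (≢-sym d′)
            ...   | refl = sv

theorem4p9 : ∀ (n : ℕ) (G : Graph n) (k : ℕ) → 2 * k ≤ n →
    ∀ (P : Typing n) → Returns G k P →
    ∀ (opt : ℕ) → IsOPT G k opt → opt ≤ 2 * IoA G P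
theorem4p9 n G k 2k≤n P (P₀ , (c₁ , c₂) , run , locallyOptimal) opt ((Q , (q₁ , _) , refl) , _) =
  subst (IoA G Q ≤_) (cong (IoA G P +_) (sym (+-identityʳ _))) bound
  where
  open ≤-Reasoning
  P-count : ∀ t → # (λ v → P v ≟ᵗ t) ≡ countVertices (λ v → P₀ v ≟ᵗ t)
  P-count t = trans (countType-run G run t) (sym (count≡# λ v → P₀ v ≟ᵗ t))

  same-count : # (λ v → Q v ≟ᵗ type₁) ≡ # (λ v → P v ≟ᵗ type₁)
  same-count = trans (sym (count≡# λ v → Q v ≟ᵗ type₁)) (trans q₁ (sym (trans (P-count type₁) c₁)))

  type₂-bound : (∀ y → P y ≡ type₂ → Integrated G P y) → IoA G Q ≤ IoA G P + IoA G P
  type₂-bound all = begin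
    IoA G Q                  ≡⟨ IoA≡# G Q ⟩
    # (integrated? G Q)      ≤⟨ #≤n (integrated? G Q) ⟩
    n                        ≤⟨ m≤n+m∸n n k ⟩
    k + (n ∸ k)              ≤⟨ +-monoˡ-≤ (n ∸ k) (m+n≤o⇒m≤o∸n k (subst (λ z → k + z ≤ n) (+-identityʳ k) 2k≤n)) ⟩
    (n ∸ k) + (n ∸ k)        ≤⟨ +-mono-≤ n∸k≤ n∸k≤ ⟩
    IoA G P + IoA G P        ∎
    where
    n∸k≤ : n ∸ k ≤ IoA G P
    n∸k≤ = begin
      n ∸ k                       ≡⟨ trans (P-count type₂) c₂ ⟨
      # (λ v → P v ≟ᵗ type₂)      ≤⟨ #-mono (λ v → P v ≟ᵗ type₂) (integrated? G P) all ⟩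
      # (integrated? G P)         ≡⟨ IoA≡# G P ⟨
      IoA G P                     ∎

  bound : IoA G Q ≤ IoA G P + IoA G P
  bound with any? (deprived? G P)
  ... | yes (v , dv) with P v ≟ᵗ type₁
  ...   | yes pv = type₂-bound (deprived₁⇒type₂-integrated G P locallyOptimal dv pv)
  ...   | no ¬pv = type₁-integrated-bound G P locallyOptimal
                     (deprived₂⇒type₁-integrated G P locallyOptimal dv (≢type₁ ¬pv)) Q same-count
  bound | no none = begin
    IoA G Q                  ≡⟨ IoA≡# G Q ⟩
    # (integrated? G Q)      ≤⟨ #-mono (integrated? G Q) (integrated? G P) kept ⟩
    # (integrated? G P)      ≡⟨ IoA≡# G P ⟨
    IoA G P                  ≤⟨ m≤m+n _ _ ⟩
    IoA G P + IoA G P        ∎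
    where
    kept : ∀ v → Integrated G Q v → Integrated G P v
    kept v i with integrated? G P v
    ... | yes j = j
    ... | no ¬j = contradiction (v , integrated⇒nonIsolated G {Q} i , ¬j) none
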